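{- Let $G$ be a simple connected graph with $n(G)\ge 4$ vertices and clique number $\omega(G)<4$ (i.e., $G$ contains no $K_4$). Then \[ \dim_l(G)\le \left\lfloor \frac{n(G)}{2}\right\rfloor . \]
   Context: For a graph $G$, $n(G)$ denotes its number of vertices and $\omega(G)$ its clique number (the largest order of a complete subgraph). $d_G(u,v)$ is the length of a shortest $u,v$-path. A vertex $w$ distinguishes vertices $u,v$ if $d_G(u,w)\neq d_G(v,w)$. A subset $W\subseteq V(G)$ is a local resolving set of $G$ if for every pair of adjacent vertices $u,v\in V(G)\setminus W$ there is a vertex $w\in W$ distinguishing $u$ and $v$. The local metric dimension $\dim_l(G)$ is the minimum cardinality of a local resolving set of $G$. -}

module Defs where

open import Data.Nat using (ℕ; zero; suc; _≤_; _/_)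
open import Data.Fin using (Fin)
open import Data.Fin.Subset using (Subset; _∈_; _∉_; ∣_∣)
open import Data.Product using (Σ; ∃; _×_)
open import Relation.Nullary using (¬_; Dec)
open import Relation.Binary.PropositionalEquality using (_≡_; _≢_)

record Graph (n : ℕ) : Set₁ where
  field
    Adj     : Fin n → Fin n → Set
    adj?    : ∀ u v → Dec (Adj u v)
    sym     : ∀ {u v} → Adj u v → Adj v u
    irrefl  : ∀ {u} → ¬ Adj u u
open Graph public

data Walk {n : ℕ} (G : Graph n) : Fin n → Fin n → ℕ → Set where
  nil  : ∀ {u} → Walk G u u 0
  cons : ∀ {u w v k} → Adj G u w → Walk G w v k → Walk G u v (suc k)

Connected : ∀ {n} → Graph n → Set
Connected G = ∀ u v → ∃ λ k → Walk G u v k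

IsDist : ∀ {n} → Graph n → Fin n → Fin n → ℕ → Set
IsDist G u v d = Walk G u v d × (∀ k → Walk G u v k → d ≤ k)

Distinguishes : ∀ {n} → Graph n → Fin n → Fin n → Fin n → Set
Distinguishes G w u v =
  ∀ d₁ d₂ → IsDist G u w d₁ → IsDist G v w d₂ → d₁ ≢ d₂

LocalResolving : ∀ {n} → Graph n → Subset n → Set
LocalResolving {n} G W =
  ∀ (u v : Fin n) → Adj G u v → u ∉ W → v ∉ W →
    ∃ λ w → w ∈ W × Distinguishes G w u v

LocalDimAtMost : ∀ {n} → Graph n → ℕ → Set
LocalDimAtMost {n} G m = ∃ λ (W : Subset n) → LocalResolving G W × ∣ W ∣ ≤ m

-- G contains K₄ : four distinct pairwise adjacent vertices
-- (adjacency implies distinctness by irreflexivity).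
HasK4 : ∀ {n} → Graph n → Set
HasK4 {n} G = ∃ λ (a : Fin n) → ∃ λ b → ∃ λ c → ∃ λ d →
  Adj G a b × Adj G a c × Adj G a d × Adj G b c × Adj G b d × Adj G c d

{-# OPTIONS --safe #-}
-- Vertices are decided a few at a time: a move puts vertices X into the resolving set W and at least
-- as many vertices Y outside it, such that every y ∈ Y is told apart from each neighbour that is not
-- in W by being adjacent, or not, to some member of W.  An undecided set that admits no move is empty.
-- Indeed, within it:
--   * an isolated vertex can be put into Y;
--   * an edge x y lying in no triangle gives X = {x}, Y = {y};
--   * two triangles a b c, a b e give X = {a, b}, Y = {c, e}, as K₄-freeness lets no neighbour of
--     c or e see both a and b;
--   * two triangles a b c, a y z sharing only a give X = {b, y}, Y = {c, z};
--   * otherwise there is an isolated triangle s t u.  If it has a neighbour w in W, adjacent to s and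
--     not to u say, then X = {t}, Y = {s, u}.
-- So the invariant to keep is that isolated undecided triangles have neighbours in W.  A triangle
-- violates it after a move only if all its remaining neighbours were in Y; such triangles
-- are removed first, by a move that puts one of those neighbours into X.
module Submission where

open import Defs
open import Data.Empty using (⊥; ⊥-elim)
open import Data.Fin using (Fin; zero; suc; _≟_)
open import Data.Fin.Properties using (any?; all?; injective⇒≤)
open import Data.Fin.Subset as Subset using (Subset; inside; outside; ⁅_⁆; _∪_; ∣_∣)
open import Data.Fin.Subset.Properties using (anySubset?; x∈⁅x⁆; x∈p∪q⁺; ∣⁅x⁆∣≡1; ∣⊥∣≡0)
  renaming (_∈?_ to _∈ˢ?_)
open import Data.List using (List; []; _∷_; _++_; length; lookup; foldr)
open import Data.List.Properties using (length-++)
open import Data.List.Membership.Propositional using (_∈_; _∉_)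
open import Data.List.Membership.Propositional.Properties using (∈-++⁺ˡ; ∈-++⁺ʳ; ∈-++⁻; ∈-lookup)
open import Data.List.Relation.Binary.Permutation.Propositional using (_↭_; refl; prep; swap; trans; ↭-sym)
open import Data.List.Relation.Binary.Permutation.Propositional.Properties using (∈-resp-↭)
open import Data.List.Relation.Unary.All using ([]; _∷_)
import Data.List.Relation.Unary.All as All
open import Data.List.Relation.Unary.AllPairs using ([]; _∷_)
open import Data.List.Relation.Unary.Any using (here; there; index)
open import Data.List.Relation.Unary.Any.Properties using (lookup-index)
open import Data.List.Relation.Unary.Unique.Propositional using (Unique)
open import Data.List.Relation.Unary.Unique.Propositional.Properties using (++⁺)
open import Data.Nat using (ℕ; zero; suc; _+_; _*_; _≤_; _<_; _/_; z≤n; s≤s; _≤?_)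
open import Data.Nat.DivMod using (/-monoˡ-≤; m*n/n≡m)
open import Data.Nat.Properties
  using ( ≤-refl; ≤-trans; ≤-reflexive; <⇒≱; n≤1+n; m≤n+m; +-suc; +-identityʳ; +-monoˡ-≤; +-monoʳ-≤
        ; +-mono-≤; *-distribʳ-+; *-comm; module ≤-Reasoning )
open import Data.Product using (∃; _×_; _,_; proj₂)
open import Data.Sum using (_⊎_; inj₁; inj₂; [_,_]′)
import Data.Sum as Sum
open import Data.Vec using ([]; _∷_)
open import Function using (_∘_; id)
open import Function.Definitions using (Injective)
open import Relation.Binary.PropositionalEquality using (_≡_; _≢_; refl; cong)
import Relation.Binary.PropositionalEquality as ≡
open import Relation.Nullary using (¬_; Dec; yes; no)
open import Relation.Nullary.Decidable using (¬?; _×-dec_; _→-dec_; _⊎-dec_; decidable-stable)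

-- Counting vertices in lists and subsets.

Unique⇒lookup-injective : ∀ {A : Set} {xs : List A} → Unique xs → Injective _≡_ _≡_ (lookup xs)
Unique⇒lookup-injective (_ ∷ _) {zero} {zero} _ = refl
Unique⇒lookup-injective {xs = _ ∷ xs} (x∉xs ∷ _) {zero} {suc j} eq =
  ⊥-elim (All.lookup x∉xs (∈-lookup {xs = xs} j) eq)
Unique⇒lookup-injective {xs = _ ∷ xs} (x∉xs ∷ _) {suc i} {zero} eq =
  ⊥-elim (All.lookup x∉xs (∈-lookup {xs = xs} i) (≡.sym eq))
Unique⇒lookup-injective (_ ∷ uniq) {suc i} {suc j} eq = cong suc (Unique⇒lookup-injective uniq eq)

Unique⇒length≤ : ∀ {n} {xs : List (Fin n)} → Unique xs → length xs ≤ n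
Unique⇒length≤ uniq = injective⇒≤ (Unique⇒lookup-injective uniq)

full⇒≤length : ∀ {n} (xs : List (Fin n)) → (∀ x → x ∈ xs) → n ≤ length xs
full⇒≤length xs full = injective⇒≤ {f = λ x → index (full x)} λ {x} {y} eq →
  ≡.trans (lookup-index (full x)) (≡.trans (cong (lookup xs) eq) (≡.sym (lookup-index (full y))))

∣p∪q∣≤∣p∣+∣q∣ : ∀ {n} (p q : Subset n) → ∣ p ∪ q ∣ ≤ ∣ p ∣ + ∣ q ∣
∣p∪q∣≤∣p∣+∣q∣ [] [] = z≤n
∣p∪q∣≤∣p∣+∣q∣ (outside ∷ p) (outside ∷ q) = ∣p∪q∣≤∣p∣+∣q∣ p q
∣p∪q∣≤∣p∣+∣q∣ (outside ∷ p) (inside  ∷ q) =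
  ≤-trans (s≤s (∣p∪q∣≤∣p∣+∣q∣ p q)) (≤-reflexive (≡.sym (+-suc ∣ p ∣ ∣ q ∣)))
∣p∪q∣≤∣p∣+∣q∣ (inside  ∷ p) (outside ∷ q) = s≤s (∣p∪q∣≤∣p∣+∣q∣ p q)
∣p∪q∣≤∣p∣+∣q∣ (inside  ∷ p) (inside  ∷ q) =
  s≤s (≤-trans (∣p∪q∣≤∣p∣+∣q∣ p q) (+-monoʳ-≤ ∣ p ∣ (n≤1+n ∣ q ∣)))

fromList : ∀ {n} → List (Fin n) → Subset n
fromList = foldr (λ x p → ⁅ x ⁆ ∪ p) Subset.⊥

∈-fromList : ∀ {n} {x : Fin n} {xs} → x ∈ xs → x Subset.∈ fromList xs
∈-fromList {x = x} (here refl) = x∈p∪q⁺ (inj₁ (x∈⁅x⁆ x))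
∈-fromList (there x∈xs) = x∈p∪q⁺ (inj₂ (∈-fromList x∈xs))

∣fromList∣≤length : ∀ {n} (xs : List (Fin n)) → ∣ fromList xs ∣ ≤ length xs
∣fromList∣≤length {n} [] = ≤-reflexive (∣⊥∣≡0 n)
∣fromList∣≤length (x ∷ xs) = ≤-trans (∣p∪q∣≤∣p∣+∣q∣ ⁅ x ⁆ (fromList xs))
  (+-mono-≤ (≤-reflexive (∣⁅x⁆∣≡1 x)) (∣fromList∣≤length xs))

-- Separation by adjacency instead of distance.

module _ {n : ℕ} (G : Graph n) where

  V : Set
  V = Fin n

  infix 4 _~_
  _~_ : V → V → Set
  _~_ = Adj G

  ~-sym : ∀ {x y} → x ~ y → y ~ x
  ~-sym = sym G

  ~⇒≢ : ∀ {x y} → x ~ y → x ≢ y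
  ~⇒≢ xy refl = irrefl G xy

  Separates : V → V → V → Set
  Separates w x y = (x ~ w × ¬ y ~ w) ⊎ (¬ x ~ w × y ~ w)

  Separates-sym : ∀ {w x y} → Separates w x y → Separates w y x
  Separates-sym (inj₁ (p , q)) = inj₂ (q , p)
  Separates-sym (inj₂ (p , q)) = inj₁ (q , p)

  separates? : ∀ w x y → Dec (Separates w x y)
  separates? w x y = (adj? G x w ×-dec ¬? (adj? G y w)) ⊎-dec (¬? (adj? G x w) ×-dec adj? G y w)

  -- The edge `x ~ w` bounds the common distance by 1, so a shortest walk from `y` to `w` would be
  -- trivial or a single edge.
  ~⇒dist≢ : ∀ {w x y} → y ≢ w → x ~ w → ¬ y ~ w →
            ∀ {d₁ d₂} → IsDist G x w d₁ → IsDist G y w d₂ → d₁ ≢ d₂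
  ~⇒dist≢ y≢w xw ¬yw (_ , x-min) (y-walk , _) refl with y-walk | x-min 1 (cons xw nil)
  ... | nil         | _ = y≢w refl
  ... | cons yw nil | _ = ¬yw yw
  ... | cons _ (cons _ _) | s≤s ()

  Separates⇒Distinguishes : ∀ {w x y} → x ≢ w → y ≢ w → Separates w x y → Distinguishes G w x y
  Separates⇒Distinguishes x≢w y≢w (inj₁ (xw , ¬yw)) _ _ dx dy = ~⇒dist≢ y≢w xw ¬yw dx dy
  Separates⇒Distinguishes x≢w y≢w (inj₂ (¬xw , yw)) _ _ dx dy = ~⇒dist≢ x≢w yw ¬xw dy dx ∘ ≡.sym

  -- Stronger than local resolving, but free of distances: a finite search decides it, which later
  -- permits arguing by contradiction.
  AdjacencyResolving : Subset n → Set
  AdjacencyResolving W = ∀ x y → x ~ y → x Subset.∉ W → y Subset.∉ W →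
                         ∃ λ w → w Subset.∈ W × Separates w x y

  adjacencyResolving? : ∀ W → Dec (AdjacencyResolving W)
  adjacencyResolving? W = all? λ x → all? λ y →
    adj? G x y →-dec ¬? (x ∈ˢ? W) →-dec ¬? (y ∈ˢ? W) →-dec
    any? λ w → (w ∈ˢ? W) ×-dec separates? w x y

  AdjacencyResolving⇒LocalResolving : ∀ {W} → AdjacencyResolving W → LocalResolving G W
  AdjacencyResolving⇒LocalResolving {W} res x y xy x∉W y∉W with res x y xy x∉W y∉W
  ... | w , w∈W , sep =
    w , w∈W , Separates⇒Distinguishes (λ { refl → x∉W w∈W }) (λ { refl → y∉W w∈W }) sep

  open import Data.List.Membership.DecPropositional (_≟_ {n}) using (_∈?_)

  -- Undecided triangles and their symmetries.

  record Triangle (D : List V) (a b c : V) : Set where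
    constructor triangle
    field
      a∉D : a ∉ D
      b∉D : b ∉ D
      c∉D : c ∉ D
      ab  : a ~ b
      ac  : a ~ c
      bc  : b ~ c

  module _ {D : List V} where

    swap₁₂ : ∀ {a b c} → Triangle D a b c → Triangle D b a c
    swap₁₂ (triangle a b c ab ac bc) = triangle b a c (~-sym ab) bc ac

    swap₂₃ : ∀ {a b c} → Triangle D a b c → Triangle D a c b
    swap₂₃ (triangle a b c ab ac bc) = triangle a c b ac ab (~-sym bc)

    ∈⇒∉D : ∀ {a b c p} → Triangle D a b c → p ∈ a ∷ b ∷ c ∷ [] → p ∉ D
    ∈⇒∉D T (here refl)                 = Triangle.a∉D T
    ∈⇒∉D T (there (here refl))         = Triangle.b∉D T
    ∈⇒∉D T (there (there (here refl))) = Triangle.c∉D T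

    -- Allows any vertex of a triangle to be taken as its first; the permutation carries membership
    -- facts over to the renamed triangle.
    toFront : ∀ {a b c p} → Triangle D a b c → p ∈ a ∷ b ∷ c ∷ [] →
              ∃ λ q → ∃ λ r → Triangle D p q r × a ∷ b ∷ c ∷ [] ↭ p ∷ q ∷ r ∷ []
    toFront T (here refl)                 = _ , _ , T , refl
    toFront T (there (here refl))         = _ , _ , swap₁₂ T , swap _ _ refl
    toFront T (there (there (here refl))) =
      _ , _ , swap₁₂ (swap₂₃ T) , trans (prep _ (swap _ _ refl)) (swap _ _ refl)

    toFront₂ : ∀ {a b c p q} → Triangle D a b c → p ∈ a ∷ b ∷ c ∷ [] → q ∈ a ∷ b ∷ c ∷ [] → p ≢ q →
               ∃ λ r → Triangle D p q r × a ∷ b ∷ c ∷ [] ↭ p ∷ q ∷ r ∷ []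
    toFront₂ T p∈T q∈T p≢q with toFront T p∈T
    ... | _ , _ , T′ , T↭T′ with ∈-resp-↭ T↭T′ q∈T
    ...   | here refl                 = ⊥-elim (p≢q refl)
    ...   | there (here refl)         = _ , T′ , T↭T′
    ...   | there (there (here refl)) = _ , swap₂₃ T′ , trans T↭T′ (prep _ (swap _ _ refl))

  -- The invariant and the moves that preserve it.

  -- For undecided `T`: once `Y` is deleted, `T` is a union of components of the undecided graph.
  Closed : List V → List V → List V → Set
  Closed D T Y = ∀ {p z} → p ∈ T → z ∉ D → p ~ z → z ∈ T ⊎ z ∈ Y

  -- W: vertices already put into the resolving set; D: all vertices decided so far.
  record Invariant (W D : List V) : Set where
    field
      unique    : Unique D
      balanced  : length W * 2 ≤ length D
      separated : ∀ {x y} → x ∈ D → x ∉ W → y ∉ W → x ~ y → ∃ λ w → w ∈ W × Separates w x y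
      attached  : ∀ {a b c} → let T = a ∷ b ∷ c ∷ [] in Triangle D a b c → Closed D T [] →
                  (∀ {p w} → p ∈ T → w ∈ W → p ~ w → ⊥) → ⊥

  -- `separated` may ignore neighbours in `D`, whose edges were treated when they were decided. A
  -- triangle with a neighbour in `X` is attached after the move, so the field `attached` concerns
  -- only triangles whose undecided outer neighbours all lie in `Y`; it demands that there are none.
  record Move (W D X Y : List V) : Set where
    field
      unique    : Unique (X ++ Y)
      undecided : ∀ {x} → x ∈ X ++ Y → x ∉ D
      nonempty  : 1 ≤ length Y
      balanced  : length X ≤ length Y
      separated : ∀ {y z} → y ∈ Y → z ∉ D → z ∉ X → y ~ z → ∃ λ w → w ∈ X ++ W × Separates w y z
      attached  : ∀ {a b c} → let T = a ∷ b ∷ c ∷ [] in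
                  Triangle D a b c → (∀ {p} → p ∈ T → p ∉ X ++ Y) → Closed D T Y →
                  ∀ {p y} → p ∈ T → y ∈ Y → p ~ y → ⊥

  move-length : ∀ {W D X Y} → Move W D X Y → length D < length ((X ++ Y) ++ D)
  move-length {W} {D} {X} {Y} m = begin-strict
    length D                            <⟨ s≤s ≤-refl ⟩
    1 + length D                        ≤⟨ +-monoˡ-≤ (length D) (Move.nonempty m) ⟩
    length Y + length D                 ≤⟨ +-monoˡ-≤ (length D) (m≤n+m _ (length X)) ⟩
    (length X + length Y) + length D    ≡⟨ cong (_+ length D) (length-++ X) ⟨
    length (X ++ Y) + length D          ≡⟨ length-++ (X ++ Y) ⟨
    length ((X ++ Y) ++ D)              ∎
    where open ≤-Reasoning

  move-Invariant : ∀ {W D X Y} → Invariant W D → Move W D X Y → Invariant (X ++ W) ((X ++ Y) ++ D)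
  move-Invariant {W} {D} {X} {Y} inv m = record
    { unique    = ++⁺ (Move.unique m) (Invariant.unique inv)
                      (λ (x∈XY , x∈D) → Move.undecided m x∈XY x∈D)
    ; balanced  = bal
    ; separated = sepd
    ; attached  = att
    }
    where
    bal : length (X ++ W) * 2 ≤ length ((X ++ Y) ++ D)
    bal = begin
      length (X ++ W) * 2                    ≡⟨ cong (_* 2) (length-++ X) ⟩
      (length X + length W) * 2              ≡⟨ *-distribʳ-+ 2 (length X) (length W) ⟩
      length X * 2 + length W * 2            ≤⟨ +-monoʳ-≤ (length X * 2) (Invariant.balanced inv) ⟩
      length X * 2 + length D                ≡⟨ cong (_+ length D) (*-comm (length X) 2) ⟩
      (length X + (length X + 0)) + length D ≡⟨ cong (λ k → length X + k + length D) (+-identityʳ (length X)) ⟩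
      (length X + length X) + length D       ≤⟨ +-monoˡ-≤ (length D) (+-monoʳ-≤ (length X) (Move.balanced m)) ⟩
      (length X + length Y) + length D       ≡⟨ cong (_+ length D) (length-++ X) ⟨
      length (X ++ Y) + length D             ≡⟨ length-++ (X ++ Y) ⟨
      length ((X ++ Y) ++ D)                 ∎
      where open ≤-Reasoning

    widen : ∀ {x y} → (∃ λ w → w ∈ W × Separates w x y) → ∃ λ w → w ∈ X ++ W × Separates w x y
    widen (w , w∈W , sep) = w , ∈-++⁺ʳ X w∈W , sep

    flip : ∀ {x y} → (∃ λ w → w ∈ W × Separates w x y) → ∃ λ w → w ∈ W × Separates w y x
    flip (w , w∈W , sep) = w , w∈W , Separates-sym sep

    sepd : ∀ {x y} → x ∈ (X ++ Y) ++ D → x ∉ X ++ W → y ∉ X ++ W → x ~ y →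
           ∃ λ w → w ∈ X ++ W × Separates w x y
    sepd {x} {y} x∈D′ x∉W′ y∉W′ xy with ∈-++⁻ (X ++ Y) x∈D′
    ... | inj₂ x∈D = widen (Invariant.separated inv x∈D (x∉W′ ∘ ∈-++⁺ʳ X) (y∉W′ ∘ ∈-++⁺ʳ X) xy)
    ... | inj₁ x∈XY with ∈-++⁻ X x∈XY
    ...   | inj₁ x∈X = ⊥-elim (x∉W′ (∈-++⁺ˡ x∈X))
    ...   | inj₂ x∈Y with y ∈? D
    -- The edge was covered when `y` was decided; only the order of its ends has to be reversed.
    ...     | yes y∈D =
      widen (flip (Invariant.separated inv y∈D (y∉W′ ∘ ∈-++⁺ʳ X) (x∉W′ ∘ ∈-++⁺ʳ X) (~-sym xy)))
    ...     | no  y∉D = Move.separated m x∈Y y∉D (y∉W′ ∘ ∈-++⁺ˡ) xy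

    -- A triangle left isolated and unattached has no neighbour in `X`, and by `Move.attached` none
    -- in `Y`. Hence it was isolated and unattached before the move too.
    att : ∀ {a b c} → let T = a ∷ b ∷ c ∷ [] in Triangle ((X ++ Y) ++ D) a b c →
          Closed ((X ++ Y) ++ D) T [] → (∀ {p w} → p ∈ T → w ∈ X ++ W → p ~ w → ⊥) → ⊥
    att {a} {b} {c} (triangle a∉ b∉ c∉ ab ac bc) closed unattached =
      Invariant.attached inv T closed-D (λ p∈T w∈W → unattached p∈T (∈-++⁺ʳ X w∈W))
      where
      T : Triangle D a b c
      T = triangle (a∉ ∘ ∈-++⁺ʳ (X ++ Y)) (b∉ ∘ ∈-++⁺ʳ (X ++ Y)) (c∉ ∘ ∈-++⁺ʳ (X ++ Y)) ab ac bc

      disjoint : ∀ {p} → p ∈ a ∷ b ∷ c ∷ [] → p ∉ X ++ Y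
      disjoint (here refl)                 = a∉ ∘ ∈-++⁺ˡ
      disjoint (there (here refl))         = b∉ ∘ ∈-++⁺ˡ
      disjoint (there (there (here refl))) = c∉ ∘ ∈-++⁺ˡ

      closed-Y : Closed D (a ∷ b ∷ c ∷ []) Y
      closed-Y {z = z} p∈T z∉D pz with z ∈? (X ++ Y)
      ... | no z∉XY = Sum.map₂ (λ ()) (closed p∈T ([ z∉XY , z∉D ]′ ∘ ∈-++⁻ (X ++ Y)) pz)
      ... | yes z∈XY with ∈-++⁻ X z∈XY
      ...   | inj₁ z∈X = ⊥-elim (unattached p∈T (∈-++⁺ˡ z∈X) pz)
      ...   | inj₂ z∈Y = inj₂ z∈Y

      closed-D : Closed D (a ∷ b ∷ c ∷ []) []
      closed-D p∈T z∉D pz with closed-Y p∈T z∉D pz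
      ... | inj₁ z∈T = inj₁ z∈T
      ... | inj₂ z∈Y = ⊥-elim (Move.attached m T disjoint closed-Y p∈T z∈Y pz)

  -- Solutions, and the initial state.

  Solution : Set
  Solution = ∃ λ (S : Subset n) → AdjacencyResolving S × ∣ S ∣ ≤ n / 2

  solution? : Dec Solution
  solution? = anySubset? λ S → adjacencyResolving? S ×-dec (∣ S ∣ ≤? n / 2)

  complete⇒Solution : ∀ {W D} → Invariant W D → (∀ x → x ∈ D) → Solution
  complete⇒Solution {W} {D} inv full = fromList W , resolving , size
    where
    resolving : AdjacencyResolving (fromList W)
    resolving x y xy x∉S y∉S =
      let w , w∈W , sep = Invariant.separated inv (full x) (x∉S ∘ ∈-fromList) (y∉S ∘ ∈-fromList) xy
      in w , ∈-fromList w∈W , sep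

    size : ∣ fromList W ∣ ≤ n / 2
    size = begin
      ∣ fromList W ∣     ≤⟨ ∣fromList∣≤length W ⟩
      length W           ≡⟨ m*n/n≡m (length W) 2 ⟨
      length W * 2 / 2   ≤⟨ /-monoˡ-≤ 2 (Invariant.balanced inv) ⟩
      length D / 2       ≤⟨ /-monoˡ-≤ 2 (Unique⇒length≤ (Invariant.unique inv)) ⟩
      n / 2              ∎
      where open ≤-Reasoning

  Walk-stays : ∀ {T u v k} → Closed [] T [] → u ∈ T → Walk G u v k → v ∈ T
  Walk-stays closed u∈T nil = u∈T
  Walk-stays closed u∈T (cons uw walk) =
    Walk-stays closed ([ id , (λ ()) ]′ (closed u∈T (λ ()) uw)) walk

  initial : 4 ≤ n → Connected G → Invariant [] []
  initial 4≤n connected = record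
    { unique    = []
    ; balanced  = z≤n
    ; separated = λ ()
    -- By connectedness an isolated triangle would be the whole graph, which has at least four
    -- vertices.
    ; attached  = λ {a} _ closed _ → <⇒≱ 4≤n
        (full⇒≤length _ λ x → Walk-stays closed (here refl) (proj₂ (connected a x)))
    }

  -- Removing triangles when there is no K₄.

  module _ (¬K₄ : ¬ HasK4 G) where

    no-K₄ : ∀ {a b c d} → a ~ b → a ~ c → a ~ d → b ~ c → b ~ d → c ~ d → ⊥
    no-K₄ ab ac ad bc bd cd = ¬K₄ (_ , _ , _ , _ , ab , ac , ad , bc , bd , cd)

    -- As `w` cannot see all three vertices, some pair `s`, `u` is separated by `w`; nothing is
    -- claimed about `t` and `w`.
    splitTriangle : ∀ {D a b c w} → Triangle D a b c → a ~ w →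
      ∃ λ t → ∃ λ s → ∃ λ u → Triangle D t s u × a ∷ b ∷ c ∷ [] ↭ t ∷ s ∷ u ∷ [] × s ~ w × ¬ u ~ w
    splitTriangle {b = b} {c} {w} T@(triangle _ _ _ ab ac bc) aw with adj? G b w | adj? G c w
    ... | no ¬bw | _      = _ , _ , _ , swap₁₂ (swap₂₃ T) , trans (prep _ (swap _ _ refl)) (swap _ _ refl) , aw , ¬bw
    ... | yes bw | no ¬cw = _ , _ , _ , swap₁₂ T , swap _ _ refl , aw , ¬cw
    ... | yes bw | yes cw = ⊥-elim (no-K₄ ab ac aw bc bw cw)

    -- Existence is stated in double-negated form below; this suffices because Solution is decidable.
    module Stuck {W D : List V} (inv : Invariant W D) (stuck : ∀ X Y → ¬ Move W D X Y) where

      has-neighbour : ∀ {x} → x ∉ D → (∀ {z} → z ∉ D → x ~ z → ⊥) → ⊥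
      has-neighbour {x} x∉D isolated = stuck [] (x ∷ []) record
        { unique    = [] ∷ []
        ; undecided = λ { (here refl) → x∉D }
        ; nonempty  = s≤s z≤n
        ; balanced  = z≤n
        ; separated = λ { (here refl) z∉D _ xz → ⊥-elim (isolated z∉D xz) }
        ; attached  = λ { T _ _ p∈T (here refl) px → isolated (∈⇒∉D T p∈T) (~-sym px) }
        }

      -- With `t` in the resolving set, the only edge left to separate is `s u`, and `w` does this.
      split-closed : ∀ {t s u w} → Triangle D t s u → Closed D (t ∷ s ∷ u ∷ []) [] →
                     w ∈ W → s ~ w → ¬ u ~ w → ⊥
      split-closed {t} {s} {u} {w} T@(triangle t∉D s∉D u∉D ts tu su) closed w∈W sw ¬uw =
        stuck (t ∷ []) (s ∷ u ∷ []) record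
          { unique    = (~⇒≢ ts ∷ ~⇒≢ tu ∷ []) ∷ (~⇒≢ su ∷ []) ∷ [] ∷ []
          ; undecided = ∈⇒∉D T
          ; nonempty  = s≤s z≤n
          ; balanced  = s≤s z≤n
          ; separated = sep
          ; attached  = λ T′ disj _ p∈T′ y∈Y py →
              [ disj p∈T′ , (λ ()) ]′ (closed (there y∈Y) (∈⇒∉D T′ p∈T′) (~-sym py))
          }
        where
        sep : ∀ {y z} → y ∈ s ∷ u ∷ [] → z ∉ D → z ∉ t ∷ [] → y ~ z →
              ∃ λ w → w ∈ t ∷ W × Separates w y z
        sep y∈Y z∉D z∉X yz with y∈Y | closed (there y∈Y) z∉D yz
        ... | _                 | inj₁ (here refl)                 = ⊥-elim (z∉X (here refl))
        ... | here refl         | inj₁ (there (here refl))         = ⊥-elim (irrefl G yz)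
        ... | here refl         | inj₁ (there (there (here refl))) = w , there w∈W , inj₁ (sw , ¬uw)
        ... | there (here refl) | inj₁ (there (here refl))         = w , there w∈W , inj₂ (¬uw , sw)
        ... | there (here refl) | inj₁ (there (there (here refl))) = ⊥-elim (irrefl G yz)

      -- The invariant gives an isolated triangle a neighbour in `W`, and then `split-closed`
      -- removes the triangle.
      has-outer-neighbour : ∀ {a b c} → let T = a ∷ b ∷ c ∷ [] in Triangle D a b c →
        (∀ {p z} → p ∈ T → z ∉ D → p ~ z → z ∉ T → ⊥) → ⊥
      has-outer-neighbour {a} {b} {c} T none =
        Invariant.attached inv T (λ p∈T z∉D pz → inj₁ (inner p∈T z∉D pz)) λ p∈T w∈W pw →
          let _ , _ , T₁ , T↭T₁ = toFront T p∈T
              _ , _ , _ , T₂ , T₁↭T₂ , sw , ¬uw = splitTriangle T₁ pw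
              T↭T₂ = trans T↭T₁ T₁↭T₂
          in split-closed T₂
               (λ p∈T₂ z∉D pz → inj₁ (∈-resp-↭ T↭T₂ (inner (∈-resp-↭ (↭-sym T↭T₂) p∈T₂) z∉D pz)))
               w∈W sw ¬uw
        where
        inner : ∀ {p z} → p ∈ a ∷ b ∷ c ∷ [] → z ∉ D → p ~ z → z ∈ a ∷ b ∷ c ∷ []
        inner {z = z} p∈T z∉D pz = decidable-stable (z ∈? _) (none p∈T z∉D pz)

      -- The triangle t s u is removed although it may keep a neighbour e besides w.
      split-off : ∀ {t s u w e} → let T = t ∷ s ∷ u ∷ []; X = w ∷ t ∷ []; Y = s ∷ u ∷ [] in
        Triangle D t s u → w ∉ D → w ∉ T → s ~ w → ¬ u ~ w → ¬ e ~ w → (u ~ e → ¬ e ~ t) →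
        Closed D T (w ∷ e ∷ []) →
        (∀ {a b c} → Triangle D a b c → (∀ {p} → p ∈ a ∷ b ∷ c ∷ [] → p ∉ X ++ Y) →
          Closed D (a ∷ b ∷ c ∷ []) Y → e ∉ a ∷ b ∷ c ∷ []) → ⊥
      split-off {t} {s} {u} {w} {e} T@(triangle t∉D s∉D u∉D ts tu su) w∉D w∉T sw ¬uw ¬ew ue⇒¬et closed e-free =
        stuck (w ∷ t ∷ []) (s ∷ u ∷ []) record
          { unique    = ((w∉T ∘ here) ∷ (w∉T ∘ there ∘ here) ∷ (w∉T ∘ there ∘ there ∘ here) ∷ [])
                        ∷ (~⇒≢ ts ∷ ~⇒≢ tu ∷ []) ∷ (~⇒≢ su ∷ []) ∷ [] ∷ []
          ; undecided = λ { (here refl) → w∉D ; (there p∈T) → ∈⇒∉D T p∈T }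
          ; nonempty  = s≤s z≤n
          ; balanced  = s≤s (s≤s z≤n)
          ; separated = sep
          ; attached  = att
          }
        where
        sep : ∀ {y z} → y ∈ s ∷ u ∷ [] → z ∉ D → z ∉ w ∷ t ∷ [] → y ~ z →
              ∃ λ x → x ∈ w ∷ t ∷ W × Separates x y z
        sep y∈Y z∉D z∉X yz with y∈Y | closed (there y∈Y) z∉D yz
        ... | _                 | inj₁ (here refl)                 = ⊥-elim (z∉X (there (here refl)))
        ... | here refl         | inj₁ (there (here refl))         = ⊥-elim (irrefl G yz)
        ... | here refl         | inj₁ (there (there (here refl))) = w , here refl , inj₁ (sw , ¬uw)
        ... | there (here refl) | inj₁ (there (here refl))         = w , here refl , inj₂ (¬uw , sw)
        ... | there (here refl) | inj₁ (there (there (here refl))) = ⊥-elim (irrefl G yz)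
        ... | _                 | inj₂ (here refl)                 = ⊥-elim (z∉X (here refl))
        ... | here refl         | inj₂ (there (here refl))         = w , here refl , inj₁ (sw , ¬ew)
        -- Neither `u` nor `e` sees `w`, so this edge is left to `t`, which sees `u` and, by
        -- hypothesis, not `e`.
        ... | there (here refl) | inj₂ (there (here refl))         =
          t , there (here refl) , inj₁ (~-sym tu , ue⇒¬et yz)

        att : ∀ {a b c} → Triangle D a b c →
              (∀ {p} → p ∈ a ∷ b ∷ c ∷ [] → p ∉ w ∷ t ∷ s ∷ u ∷ []) →
              Closed D (a ∷ b ∷ c ∷ []) (s ∷ u ∷ []) →
              ∀ {p y} → p ∈ a ∷ b ∷ c ∷ [] → y ∈ s ∷ u ∷ [] → p ~ y → ⊥
        att T′ disj closed′ p∈T′ y∈Y py with closed (there y∈Y) (∈⇒∉D T′ p∈T′) (~-sym py)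
        ... | inj₁ p∈T                 = disj p∈T′ (there p∈T)
        ... | inj₂ (here refl)         = disj p∈T′ (here refl)
        -- Only a triangle through `e` can lose a neighbour in `Y`; excluding it is left to the
        -- caller.
        ... | inj₂ (there (here refl)) = e-free T′ disj closed′ p∈T′

      -- The case e = w of split-off.
      no-pendant-triangle : ∀ {a b c p w} → let T = a ∷ b ∷ c ∷ [] in Triangle D a b c → w ∉ D → w ∉ T →
        p ∈ T → p ~ w → Closed D T (w ∷ []) → ⊥
      no-pendant-triangle T w∉D w∉T p∈T pw closed =
        let _ , _ , T₁ , T↭T₁ = toFront T p∈T
            _ , _ , _ , T₂ , T₁↭T₂ , sw , ¬uw = splitTriangle T₁ pw
            T↭T₂ = trans T↭T₁ T₁↭T₂
        in split-off T₂ w∉D (w∉T ∘ ∈-resp-↭ (↭-sym T↭T₂)) sw ¬uw (irrefl G) (⊥-elim ∘ ¬uw)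
             (λ p∈T₂ z∉D pz → Sum.map (∈-resp-↭ T↭T₂) (λ { (here eq) → here eq })
               (closed (∈-resp-↭ (↭-sym T↭T₂) p∈T₂) z∉D pz))
             (λ _ disj _ w∈T′ → disj w∈T′ (here refl))

      -- Edges, diamonds and bowties.

      -- Otherwise `x` separates `y` from every undecided neighbour of `y`. A triangle isolated by
      -- this move would hang on `y` alone, against `no-pendant-triangle`.
      edge-in-triangle : ∀ {x y} → x ∉ D → y ∉ D → x ~ y → (∀ {z} → z ∉ D → z ~ x → z ~ y → ⊥) → ⊥
      edge-in-triangle {x} {y} x∉D y∉D xy none = stuck (x ∷ []) (y ∷ []) record
        { unique    = (~⇒≢ xy ∷ []) ∷ [] ∷ []
        ; undecided = λ { (here refl) → x∉D ; (there (here refl)) → y∉D }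
        ; nonempty  = s≤s z≤n
        ; balanced  = s≤s z≤n
        ; separated = λ { (here refl) z∉D _ yz →
            x , here refl , inj₁ (~-sym xy , λ zx → none z∉D zx (~-sym yz)) }
        ; attached  = λ { T disj closed p∈T (here refl) py →
            no-pendant-triangle T y∉D (λ y∈T → disj y∈T (there (here refl))) p∈T py closed }
        }

      -- The obstruction to using the diamond a b | c e as a move.
      no-triangle-behind-diamond : ∀ {a c e p q r s} → let T = q ∷ r ∷ s ∷ [] in
        a ∉ D → c ∉ D → a ~ c → a ~ e → ¬ e ~ c →
        Triangle D q r s → (∀ {p} → p ∈ T → p ∉ a ∷ c ∷ []) → Closed D T (c ∷ e ∷ []) →
        p ∈ T → p ~ c → ⊥
      no-triangle-behind-diamond {a} {c} {e} {p} {q} {r} {s} a∉D c∉D ac ae ¬ec T disj closed p∈T pc =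
        -- The edge `p c` lies in some triangle `p c z`. Since neither `c` nor `e` is adjacent to
        -- `c`, this `z` belongs to `T`.
        edge-in-triangle (∈⇒∉D T p∈T) c∉D pc λ {z} z∉D zp zc → neighbour zp zc (closed p∈T z∉D (~-sym zp))
        where
        remove : ∀ {t s′ u} → Triangle D t s′ u → q ∷ r ∷ s ∷ [] ↭ t ∷ s′ ∷ u ∷ [] →
                 s′ ~ c → ¬ u ~ c → (u ~ e → ¬ e ~ t) → ⊥
        remove T′ T↭T′ sc ¬uc ue⇒¬et =
          split-off T′ c∉D (λ c∈T′ → disj (back c∈T′) (there (here refl))) sc ¬uc ¬ec ue⇒¬et
            (λ p∈T′ z∉D pz → Sum.map₁ (∈-resp-↭ T↭T′) (closed (back p∈T′) z∉D pz))
            (λ _ disj″ closed″ e∈T″ →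
              -- The component of e contains a, hence the neighbour c of a.
              [ (λ a∈T″ → [ (λ c∈T″ → disj″ c∈T″ (here refl))
                          , (λ c∈Y → disj (back (there c∈Y)) (there (here refl))) ]′
                          (closed″ a∈T″ c∉D ac))
              , (λ a∈Y → disj (back (there a∈Y)) (here refl)) ]′
              (closed″ e∈T″ a∉D (~-sym ae)))
          where
          back : ∀ {x} → x ∈ _ → x ∈ q ∷ r ∷ s ∷ []
          back = ∈-resp-↭ (↭-sym T↭T′)

        neighbour : ∀ {z} → z ~ p → z ~ c → z ∈ q ∷ r ∷ s ∷ [] ⊎ z ∈ c ∷ e ∷ [] → ⊥
        neighbour zp zc (inj₂ (here refl))         = irrefl G zc
        neighbour zp zc (inj₂ (there (here refl))) = ¬ec zc
        neighbour {z} zp zc (inj₁ z∈T) with toFront₂ T p∈T z∈T (~⇒≢ zp ∘ ≡.sym)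
        -- Both `p` and `z` see `c`, hence `u` does not. The vertex put into the resolving set
        -- together with `c` is `p` if `e` misses `p`, and `z` otherwise: `e` cannot see all of `p`,
        -- `z`, `u`.
        ... | u , T′@(triangle _ _ _ pz pu zu) , T↭T′ with adj? G e p
        ...   | no ¬ep = remove T′ T↭T′ zc (λ uc → no-K₄ pz pu pc zu zc uc) (λ _ → ¬ep)
        ...   | yes ep = remove (swap₁₂ T′) (trans T↭T′ (swap _ _ refl)) pc (λ uc → no-K₄ pz pu pc zu zc uc)
                           (λ ue ez → no-K₄ pz pu (~-sym ep) zu (~-sym ez) ue)

      no-diamond : ∀ {a b c e} → a ∉ D → b ∉ D → c ∉ D → e ∉ D →
                   a ~ b → c ~ a → c ~ b → e ~ a → e ~ b → c ≢ e → ⊥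
      no-diamond {a} {b} {c} {e} a∉D b∉D c∉D e∉D ab ca cb ea eb c≢e =
        stuck (a ∷ b ∷ []) (c ∷ e ∷ []) record
          { unique    = (~⇒≢ ab ∷ ~⇒≢ ac ∷ ~⇒≢ ae ∷ []) ∷ (~⇒≢ (~-sym cb) ∷ ~⇒≢ (~-sym eb) ∷ [])
                        ∷ (c≢e ∷ []) ∷ [] ∷ []
          ; undecided = λ { (here refl) → a∉D ; (there (here refl)) → b∉D
                          ; (there (there (here refl))) → c∉D ; (there (there (there (here refl)))) → e∉D }
          ; nonempty  = s≤s z≤n
          ; balanced  = s≤s (s≤s z≤n)
          ; separated = λ { (here refl) _ _ yz → sep ca cb yz ; (there (here refl)) _ _ yz → sep ea eb yz }
          -- The two cases differ by exchanging `c` and `e`.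
          ; attached  = λ
            { T disj closed p∈T (here refl) →
                no-triangle-behind-diamond a∉D c∉D ac ae ¬ec T
                  (λ { p∈T (here refl) → disj p∈T (here refl)
                     ; p∈T (there (here refl)) → disj p∈T (there (there (here refl))) })
                  closed p∈T
            ; T disj closed p∈T (there (here refl)) →
                no-triangle-behind-diamond a∉D e∉D ae ac (¬ec ∘ ~-sym) T
                  (λ { p∈T (here refl) → disj p∈T (here refl)
                     ; p∈T (there (here refl)) → disj p∈T (there (there (there (here refl)))) })
                  (λ p∈T z∉D pz → Sum.map₂ (∈-resp-↭ (swap c e refl)) (closed p∈T z∉D pz)) p∈T
            }
          }
        where
        ac : a ~ c
        ac = ~-sym ca

        ae : a ~ e
        ae = ~-sym ea

        ¬ec : ¬ e ~ c
        ¬ec ec = no-K₄ ab ac ae (~-sym cb) (~-sym eb) (~-sym ec)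

        sep : ∀ {y z} → y ~ a → y ~ b → y ~ z → ∃ λ w → w ∈ a ∷ b ∷ W × Separates w y z
        sep {y} {z} ya yb yz with adj? G z a | adj? G z b
        ... | no ¬za | _      = a , here refl , inj₁ (ya , ¬za)
        ... | yes za | no ¬zb = b , there (here refl) , inj₁ (yb , ¬zb)
        ... | yes za | yes zb = ⊥-elim (no-K₄ ya yb yz ab (~-sym za) (~-sym zb))

      -- Without diamonds the edges `c y`, `c z` and `z b` are absent. So `y` separates `c` from
      -- `a`, and `b` separates `z` from `a`, while `b` and `y` deal with the other neighbours of
      -- `c` and `z`.
      no-bowtie : ∀ {a b c y z} → Triangle D a b c → Triangle D a y z →
                  b ≢ y → b ≢ z → c ≢ y → c ≢ z → ⊥
      no-bowtie {a} {b} {c} {y} {z} (triangle a∉D b∉D c∉D ab ac bc) (triangle _ y∉D z∉D ay az yz) b≢y b≢z c≢y c≢z =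
        stuck (b ∷ y ∷ []) (c ∷ z ∷ []) record
          { unique    = (b≢y ∷ ~⇒≢ bc ∷ b≢z ∷ []) ∷ ((c≢y ∘ ≡.sym) ∷ ~⇒≢ yz ∷ []) ∷ (c≢z ∷ []) ∷ [] ∷ []
          ; undecided = λ { (here refl) → b∉D ; (there (here refl)) → y∉D
                          ; (there (there (here refl))) → c∉D ; (there (there (there (here refl)))) → z∉D }
          ; nonempty  = s≤s z≤n
          ; balanced  = s≤s (s≤s z≤n)
          ; separated = λ
            { (here refl) v∉D _ cv → sep b∉D c∉D ab ac bc (here refl) (there (here refl)) ay ¬cy v∉D cv
            ; (there (here refl)) v∉D _ zv → sep y∉D z∉D ay az yz (there (here refl)) (here refl) ab ¬zb v∉D zv
            }
          ; attached  = λ T disj closed p∈T v∈Y pv →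
              -- The triangle `p v q` has `q` in `T`, because `Y` is independent; with the third
              -- vertex `r` of `T` it forms a diamond on the edge `p q`.
              edge-in-triangle (∈⇒∉D T p∈T) (Y∉D v∈Y) pv λ q∉D qp qv →
                [ (λ q∈T →
                    let r , triangle _ _ r∉D pq pr qr , T↭T′ = toFront₂ T p∈T q∈T (~⇒≢ qp ∘ ≡.sym)
                        r∈T = ∈-resp-↭ (↭-sym T↭T′) (there (there (here refl)))
                    in no-diamond (∈⇒∉D T p∈T) q∉D r∉D (Y∉D v∈Y) pq (~-sym pr) (~-sym qr) (~-sym pv) (~-sym qv)
                         (λ { refl → disj r∈T (there (there v∈Y)) }))
                , (λ q∈Y → Y-independent q∈Y v∈Y qv) ]′
                (closed p∈T q∉D (~-sym qp))
          }
        where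
        ¬cy : ¬ c ~ y
        ¬cy cy = no-diamond a∉D c∉D b∉D y∉D ac (~-sym ab) bc (~-sym ay) (~-sym cy) b≢y

        ¬cz : ¬ c ~ z
        ¬cz cz = no-diamond a∉D c∉D b∉D z∉D ac (~-sym ab) bc (~-sym az) (~-sym cz) b≢z

        ¬zb : ¬ z ~ b
        ¬zb zb = no-diamond a∉D b∉D c∉D z∉D ab (~-sym ac) (~-sym bc) (~-sym az) zb c≢z

        Y∉D : ∀ {v} → v ∈ c ∷ z ∷ [] → v ∉ D
        Y∉D (here refl)         = c∉D
        Y∉D (there (here refl)) = z∉D

        Y-independent : ∀ {v w} → v ∈ c ∷ z ∷ [] → w ∈ c ∷ z ∷ [] → ¬ v ~ w
        Y-independent (here refl)         (here refl)         = irrefl G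
        Y-independent (here refl)         (there (here refl)) = ¬cz
        Y-independent (there (here refl)) (here refl)         = ¬cz ∘ ~-sym
        Y-independent (there (here refl)) (there (here refl)) = irrefl G

        -- x separates x′ from all its neighbours but a, and w separates x′ from a.
        sep : ∀ {x x′ w v} → x ∉ D → x′ ∉ D → a ~ x → a ~ x′ → x ~ x′ →
              x ∈ b ∷ y ∷ [] → w ∈ b ∷ y ∷ [] → a ~ w → ¬ x′ ~ w → v ∉ D → x′ ~ v →
              ∃ λ w → w ∈ b ∷ y ∷ W × Separates w x′ v
        sep {x} {x′} {w} {v} x∉D x′∉D ax ax′ xx′ x∈X w∈X aw ¬x′w v∉D x′v with adj? G v x | v ≟ a
        ... | no ¬vx | _        = x , ∈-++⁺ˡ x∈X , inj₁ (~-sym xx′ , ¬vx)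
        ... | yes vx | yes refl = w , ∈-++⁺ˡ w∈X , inj₂ (¬x′w , aw)
        ... | yes vx | no v≢a   = ⊥-elim (no-diamond x∉D x′∉D v∉D a∉D xx′ vx (~-sym x′v) ax ax′ v≢a)

      -- An undecided vertex lies on an edge, the edge in a triangle, and some vertex `p` of the
      -- triangle has a neighbour `w` outside it. The edge `p w` lies in a second triangle, which
      -- yields a bowtie at `p`.
      all-decided : ∀ {x} → x ∉ D → ⊥
      all-decided {x} x∉D =
        has-neighbour x∉D λ y∉D xy →
        edge-in-triangle x∉D y∉D xy λ z∉D zx zy →
        let T = triangle x∉D y∉D z∉D xy (~-sym zx) (~-sym zy) in
        has-outer-neighbour T λ {p} {w} p∈T w∉D pw w∉T →
        let b , c , T′@(triangle p∉D b∉D c∉D pb pc bc) , T↭T′ = toFront T p∈T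
            w∉T′ = w∉T ∘ ∈-resp-↭ (↭-sym T↭T′)
            b≢w = λ b≡w → w∉T′ (there (here (≡.sym b≡w)))
            c≢w = λ c≡w → w∉T′ (there (there (here (≡.sym c≡w))))
        in edge-in-triangle p∉D w∉D pw λ q∉D qp qw →
           no-bowtie T′ (triangle p∉D w∉D q∉D pw (~-sym qp) (~-sym qw))
             b≢w
             -- If the third vertex of the second triangle is `b` or `c`, the two triangles share an
             -- edge.
             (λ { refl → no-diamond p∉D b∉D c∉D w∉D pb (~-sym pc) (~-sym bc) (~-sym pw) (~-sym qw) c≢w })
             c≢w
             (λ { refl → no-diamond p∉D c∉D b∉D w∉D pc (~-sym pb) bc (~-sym pw) (~-sym qw) b≢w })

    -- Induction on the undecided vertices.

    -- Here `k` bounds the number of undecided vertices. If there is no solution, the induction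
    -- hypothesis refutes every move, so the state is stuck and `all-decided` applies.
    Invariant⇒Solution : ∀ k {W D} → n ≤ length D + k → Invariant W D → ¬ ¬ Solution
    Invariant⇒Solution k {W} {D} bound inv ¬sol with any? (λ x → ¬? (x ∈? D))
    ... | no  none       = ¬sol (complete⇒Solution inv λ x → decidable-stable (x ∈? D) (λ x∉D → none (x , x∉D)))
    ... | yes (x , x∉D) = Stuck.all-decided inv (stuck k bound) x∉D
      where
      stuck : ∀ k → n ≤ length D + k → ∀ X Y → ¬ Move W D X Y
      -- Already `n` vertices are decided, and a move would give a longer list without repetitions.
      stuck zero bound X Y m = <⇒≱ (move-length m)
        (≤-trans (Unique⇒length≤ (Invariant.unique (move-Invariant inv m)))
          (≤-trans bound (≤-reflexive (+-identityʳ (length D)))))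
      stuck (suc k) bound X Y m = Invariant⇒Solution k
        (≤-trans bound (≤-trans (≤-reflexive (+-suc (length D) k)) (+-monoˡ-≤ k (move-length m))))
        (move-Invariant inv m) ¬sol

theorem3 : ∀ (n : ℕ) (G : Graph n) → 4 ≤ n → Connected G → ¬ HasK4 G →
    LocalDimAtMost G (n / 2)
theorem3 n G 4≤n connected ¬K₄ =
  -- Searching all subsets decides `Solution`, so its double negation suffices.
  let S , resolving , size = decidable-stable (solution? G)
        (Invariant⇒Solution G ¬K₄ n ≤-refl (initial G 4≤n connected))
  in S , AdjacencyResolving⇒LocalResolving G resolving , size
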